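{- Let $P$ be a periodic isonemal prefabric of order greater than $4$ with only parallel symmetry axes, that is, whose planar symmetry group $G_1$ contains no non-trivial rotation and contains reflections or glide-reflections, the axes of which are all parallel to one another. Then the prefabric obtained from $P$ by doubling is not isonemal.
   Context: **Prefabrics and designs.** The plane is tessellated by the unit square cells $[i,i+1]\times[j,j+1]$, $i,j\in\mathbb{Z}$. The vertical strips $[i,i+1]\times\mathbb{R}$ are the strands called warps and the horizontal strips $\mathbb{R}\times[j,j+1]$ are the strands called wefts. A (two-layer) prefabric specifies, for each cell, which of the two strands crossing there is uppermost. It is encoded by its design $c:\mathbb{Z}^2\to\{\text{dark},\text{pale}\}$, where $c(i,j)$ is dark if the warp is uppermost in cell $(i,j)$ and pale if the weft is uppermost. **Symmetries.** Let $\tau$ denote reflection in the plane of the prefabric (reversing which strand is uppermost everywhere). A symmetry is a pair $(g,\varepsilon)$, with $\varepsilon\in\{e,\tau\}$, where $g$ is an isometry of the plane mapping strands to strands such that, for every cell $s$, the strand uppermost in $s$ is mapped by $g$ to the strand that is uppermost in $g(s)$ if $\varepsilon=e$, and to the strand that is lowermost in $g(s)$ if $\varepsilon=\tau$. (Hence a $g$ preserving the strand directions preserves colours of the design if $\varepsilon=e$ and reverses them if $\varepsilon=\tau$; a $g$ interchanging warps and wefts reverses colours if $\varepsilon=e$ and preserves them if $\varepsilon=\tau$.) The symmetries form the group $G$. $G_1$ is the group of all $g$ such that $(g,e)$ or $(g,\tau)$ is in $G$. **Periodic, isonemal, order.** The prefabric is periodic if $G$ contains pairs $(t_1,e)$,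 $(t_2,e)$ with $t_1,t_2$ linearly independent translations. It is isonemal if its symmetry group acts transitively on the set of all strands (warps and wefts together). The order of a periodic isonemal prefabric is the (least) period of the colour sequence along a strand; it is the same for all strands. **Doubling.** Doubling a prefabric replaces each strand by a pair of adjacent strands with the same behaviour: the doubled prefabric has design $c'(i,j)=c(\lfloor i/2\rfloor,\lfloor j/2\rfloor)$. -}

module Defs where

open import Data.Integer.Base as ℤ using (ℤ; +_)
open import Data.Integer.DivMod using (_/ℕ_)
open import Data.Nat.Base as ℕ using (ℕ)
open import Data.Product using (_×_; _,_; ∃; ∃-syntax)
open import Data.Rational.Base using (ℚ; 0ℚ; 1ℚ; _+_; _*_; _-_; -_; _≤_; _/_)
open import Function.Bundles using (_⇔_)
open import Level using (0ℓ)
open import Relation.Binary.PropositionalEquality using (_≡_; _≢_)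
open import Relation.Nullary using (¬_)
open import Relation.Unary using (Pred)

-- The plane has rational coordinates.  Every isometry of ℝ² mapping strands to
-- strands has the form p ↦ A p + b with A a signed permutation matrix and b
-- integral, so these isometries correspond by restriction to those of ℚ²; their
-- rotation centres and symmetry axes are rational too.

Plane : Set
Plane = ℚ × ℚ

infixl 6 _⊕_ _⊖_
infixl 7 _·_
infix 4 _∥_

𝟎 : Plane
𝟎 = 0ℚ , 0ℚ

_⊕_ _⊖_ : Plane → Plane → Plane
(x , y) ⊕ (x′ , y′) = x + x′ , y + y′
(x , y) ⊖ (x′ , y′) = x - x′ , y - y′

_·_ : ℚ → Plane → Plane
a · (x , y) = a * x , a * y

perp : Plane → Plane
perp (x , y) = - y , x

dist² : Plane → Plane → ℚ
dist² (x , y) (x′ , y′) = (x - x′) * (x - x′) + (y - y′) * (y - y′)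

-- The image of S under g is T.
MapsOnto : (Plane → Plane) → Pred Plane 0ℓ → Pred Plane 0ℓ → Set
MapsOnto g S T = ∀ q → T q ⇔ (∃[ p ] (S p × g p ≡ q))

IsIsometry : (Plane → Plane) → Set
IsIsometry g = ∀ p q → dist² (g p) (g q) ≡ dist² p q

IsTranslationBy : Plane → (Plane → Plane) → Set
IsTranslationBy v g = ∀ p → g p ≡ p ⊕ v

LinearlyIndependent : Plane → Plane → Set
LinearlyIndependent v w = ∀ a b → (a · v) ⊕ (b · w) ≡ 𝟎 → a ≡ 0ℚ × b ≡ 0ℚ

-- Linear rotation by the angle with cosine a and sine b.
rotate : ℚ → ℚ → Plane → Plane
rotate a b (x , y) = a * x - b * y , b * x + a * y

record IsRotation (g : Plane → Plane) : Set where
  field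
    centre : Plane
    cosine : ℚ
    sine   : ℚ
    unit   : cosine * cosine + sine * sine ≡ 1ℚ
    acts   : ∀ p → g p ≡ centre ⊕ rotate cosine sine (p ⊖ centre)

IsNontrivialRotation : (Plane → Plane) → Set
IsNontrivialRotation g = IsRotation g × ¬ (∀ p → g p ≡ p)

record Line : Set where
  field
    point       : Plane
    direction   : Plane
    direction≢𝟎 : direction ≢ 𝟎

_∥_ : Line → Line → Set
ℓ ∥ m = ∃[ k ] (Line.direction m ≡ k · Line.direction ℓ)

-- Reflection in ℓ followed by translation by t times its direction vector:
-- a reflection if t is zero and a glide-reflection otherwise.
IsGlide : Line → ℚ → (Plane → Plane) → Set
IsGlide ℓ t g = ∀ x y →
  g (o ⊕ (x · d) ⊕ (y · perp d)) ≡ o ⊕ ((x + t) · d) ⊖ (y · perp d)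
  where
  o = Line.point ℓ
  d = Line.direction ℓ

HasAxis : (Plane → Plane) → Line → Set
HasAxis g ℓ = ∃[ t ] IsGlide ℓ t g

data Strand : Set where
  warp weft : ℤ → Strand

Cell : Set
Cell = ℤ × ℤ

InUnitInterval : ℤ → Pred ℚ 0ℓ
InUnitInterval i x = (i / 1 ≤ x) × (x ≤ (i ℤ.+ + 1) / 1)

strandRegion : Strand → Pred Plane 0ℓ
strandRegion (warp i) (x , y) = InUnitInterval i x
strandRegion (weft j) (x , y) = InUnitInterval j y

cellRegion : Cell → Pred Plane 0ℓ
cellRegion (i , j) (x , y) = InUnitInterval i x × InUnitInterval j y

data Colour : Set where
  dark pale : Colour

Design : Set
Design = ℤ → ℤ → Colour

upper lower : Design → Cell → Strand
upper c (i , j) with c i j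
... | dark = warp i
... | pale = weft j
lower c (i , j) with c i j
... | dark = weft j
... | pale = warp i

data Side : Set where
  e τ : Side

visible : Side → Design → Cell → Strand
visible e = upper
visible τ = lower

record IsSymmetry (c : Design) (g : Plane → Plane) (ε : Side) : Set where
  field
    isometry : IsIsometry g
    strands  : ∀ s → ∃[ t ] MapsOnto g (strandRegion s) (strandRegion t)
    sides    : ∀ s s′ → MapsOnto g (cellRegion s) (cellRegion s′) →
               MapsOnto g (strandRegion (upper c s)) (strandRegion (visible ε c s′))

G₁ : Design → (Plane → Plane) → Set
G₁ c g = ∃[ ε ] IsSymmetry c g ε

record Periodic (c : Design) : Set where
  field
    t₁ t₂        : Plane → Plane
    v₁ v₂        : Plane
    translation₁ : IsTranslationBy v₁ t₁
    translation₂ : IsTranslationBy v₂ t₂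
    symmetry₁    : IsSymmetry c t₁ e
    symmetry₂    : IsSymmetry c t₂ e
    independent  : LinearlyIndependent v₁ v₂

Isonemal : Design → Set
Isonemal c = ∀ s t → ∃[ g ] ∃[ ε ]
  (IsSymmetry c g ε × MapsOnto g (strandRegion s) (strandRegion t))

coloursAlong : Design → Strand → ℤ → Colour
coloursAlong c (warp i) k = c i k
coloursAlong c (weft j) k = c k j

IsPeriod : (ℤ → Colour) → ℕ → Set
IsPeriod f n = 0 ℕ.< n × (∀ k → f (k ℤ.+ + n) ≡ f k)

IsLeastPeriod : (ℤ → Colour) → ℕ → Set
IsLeastPeriod f n = IsPeriod f n × (∀ m → IsPeriod f m → n ℕ.≤ m)

-- For an isonemal design all strands have the same least period, so one strand
-- determines the order.
HasOrder : Design → ℕ → Set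
HasOrder c n = ∃[ s ] IsLeastPeriod (coloursAlong c s) n

record OnlyParallelAxes (c : Design) : Set where
  field
    noRotation : ∀ g → G₁ c g → ¬ IsNontrivialRotation g
    someAxis   : ∃[ g ] ∃[ ℓ ] (G₁ c g × HasAxis g ℓ)
    parallel   : ∀ g h ℓ m → G₁ c g → G₁ c h → HasAxis g ℓ → HasAxis h m → ℓ ∥ m

-- _/ℕ_ rounds towards -∞.
double : Design → Design
double c i j = c (i /ℕ 2) (j /ℕ 2)

{-# OPTIONS --safe #-}
module Submission where

open import Defs
open import Data.Empty using (⊥)
open import Data.Integer.Base as ℤ using (ℤ; +_)
open import Data.Integer.DivMod
  using (_/ℕ_; _%ℕ_; a≡a%ℕn+[a/ℕn]*n; n%ℕd<d; [n/ℕd]*d≤n; n<s[n/ℕd]*d)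
import Data.Integer.Properties as ℤ
import Data.Integer.Tactic.RingSolver as ℤ-Ring
open import Data.Nat.Base as ℕ using (ℕ; _<_)
import Data.Nat.Properties as ℕ
open import Data.Product using (_×_; _,_; proj₁; proj₂; ∃-syntax)
open import Data.Rational.Base
  using (ℚ; 0ℚ; 1ℚ; ½; toℚᵘ; _+_; _*_; _-_; -_; _≤_; _/_; 1/_; ≢-nonZero; nonNegative; nonPositive)
import Data.Rational.Properties as ℚ
import Data.Rational.Unnormalised.Base as ℚᵘ
import Data.Rational.Unnormalised.Properties as ℚᵘ
open import Data.Sum.Base using (_⊎_; inj₁; inj₂)
open import Function.Base using (_∘_)
open import Function.Bundles using (mk⇔; module Equivalence)
open import Level using (0ℓ)
open import Relation.Binary.PropositionalEquality
  using (_≡_; _≢_; refl; sym; trans; cong; cong₂; subst; subst₂; module ≡-Reasoning)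
open import Relation.Nullary using (¬_; yes; no; contradiction)
open import Relation.Nullary.Decidable.Core using (dec⇒maybe)
open import Tactic.RingSolver using (solve-∀)
open import Tactic.RingSolver.Core.AlmostCommutativeRing using (AlmostCommutativeRing; fromCommutativeRing)

-- A symmetry g of the doubled prefabric taking warp 0 to warp 1 acts on each
-- coordinate by a shift or a flip.  If one of these does not respect the pairs of
-- equal strands, then all warps or all wefts of P agree; as P has a symmetry
-- exchanging warps and wefts, every strand of P is then monochromatic and P has
-- order 1.  Otherwise the first coordinate is flipped and g, scaled by one half, is
-- a symmetry of P: a half-turn, which is excluded, or a glide-reflection with
-- vertical axis.  The exchanging symmetry is not a rotation either, so it has an
-- oblique axis, which is not parallel to the vertical one.

-- Integers inside the rationals, and squares of rationals

ℚ-ring : AlmostCommutativeRing 0ℓ 0ℓ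
ℚ-ring = fromCommutativeRing ℚ.+-*-commutativeRing (λ x → dec⇒maybe (0ℚ ℚ.≟ x))

-- `i / 1` is a reduced fraction, and its reduction is stuck on a variable `i`; the unreduced
-- representative over 1 computes freely. The second argument of `mkℚᵘ` is the denominator minus
-- one, hence 0.
toℚᵘ-/1 : ∀ i → toℚᵘ (i / 1) ℚᵘ.≃ ℚᵘ.mkℚᵘ i 0
toℚᵘ-/1 i = ℚ.toℚᵘ-fromℚᵘ (ℚᵘ.mkℚᵘ i 0)

/1-homo-+ : ∀ i j → (i ℤ.+ j) / 1 ≡ i / 1 + j / 1
/1-homo-+ i j = ℚ.toℚᵘ-injective (begin
  toℚᵘ ((i ℤ.+ j) / 1)                  ≈⟨ toℚᵘ-/1 (i ℤ.+ j) ⟩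
  ℚᵘ.mkℚᵘ (i ℤ.+ j) 0                   ≈⟨ ℚᵘ.*≡* (lemma i j) ⟩
  ℚᵘ.mkℚᵘ i 0 ℚᵘ.+ ℚᵘ.mkℚᵘ j 0          ≈⟨ ℚᵘ.+-cong (toℚᵘ-/1 i) (toℚᵘ-/1 j) ⟨
  toℚᵘ (i / 1) ℚᵘ.+ toℚᵘ (j / 1)        ≈⟨ ℚ.toℚᵘ-homo-+ (i / 1) (j / 1) ⟨
  toℚᵘ (i / 1 + j / 1)                  ∎)
  where
  open import Relation.Binary.Reasoning.Setoid ℚᵘ.≃-setoid
  lemma : ∀ i j → (i ℤ.+ j) ℤ.* + 1 ≡ (i ℤ.* + 1 ℤ.+ j ℤ.* + 1) ℤ.* + 1
  lemma = ℤ-Ring.solve-∀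

/1-homo-neg : ∀ i → (ℤ.- i) / 1 ≡ - (i / 1)
/1-homo-neg i = ℚ.toℚᵘ-injective (begin
  toℚᵘ ((ℤ.- i) / 1)  ≈⟨ toℚᵘ-/1 (ℤ.- i) ⟩
  ℚᵘ.- ℚᵘ.mkℚᵘ i 0    ≈⟨ ℚᵘ.-‿cong (toℚᵘ-/1 i) ⟨
  ℚᵘ.- toℚᵘ (i / 1)   ≈⟨ ℚ.toℚᵘ-homo‿- (i / 1) ⟨
  toℚᵘ (- (i / 1))    ∎)
  where
  open import Relation.Binary.Reasoning.Setoid ℚᵘ.≃-setoid

/1-cancel-≤ : ∀ {i j} → i / 1 ≤ j / 1 → i ℤ.≤ j
/1-cancel-≤ {i} {j} i≤j = subst₂ ℤ._≤_ (ℤ.*-identityʳ i) (ℤ.*-identityʳ j) (ℚᵘ.drop-*≤*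
  (ℚᵘ.≤-respˡ-≃ (toℚᵘ-/1 i) (ℚᵘ.≤-respʳ-≃ (toℚᵘ-/1 j) (ℚ.toℚᵘ-mono-≤ i≤j))))

square-nonNegative : ∀ x → 0ℚ ≤ x * x
square-nonNegative x with ℚ.≤-total 0ℚ x
... | inj₁ 0≤x = ℚ.nonNegative⁻¹ (x * x) {{ℚ.nonNeg*nonNeg⇒nonNeg x {{nonNegative 0≤x}} x {{nonNegative 0≤x}}}}
... | inj₂ x≤0 = ℚ.nonNegative⁻¹ (x * x) {{ℚ.nonPos*nonPos⇒nonPos x {{nonPositive x≤0}} x {{nonPositive x≤0}}}}

*-cancelʳ-0 : ∀ {x y} → y ≢ 0ℚ → x * y ≡ 0ℚ → x ≡ 0ℚ
*-cancelʳ-0 {x} {y} y≢0 xy≡0 = begin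
  x                ≡⟨ ℚ.*-identityʳ x ⟨
  x * 1ℚ           ≡⟨ cong (x *_) (ℚ.*-inverseʳ y) ⟨
  x * (y * 1/ y)   ≡⟨ ℚ.*-assoc x y (1/ y) ⟨
  x * y * 1/ y     ≡⟨ cong (_* 1/ y) xy≡0 ⟩
  0ℚ * 1/ y        ≡⟨ ℚ.*-zeroˡ (1/ y) ⟩
  0ℚ               ∎
  where
  open ≡-Reasoning
  instance _ = ≢-nonZero y≢0

square-zero : ∀ {x} → x * x ≡ 0ℚ → x ≡ 0ℚ
square-zero {x} xx≡0 with x ℚ.≟ 0ℚ
... | yes x≡0 = x≡0
... | no  x≢0 = *-cancelʳ-0 x≢0 xx≡0

sum-of-squares-zero : ∀ x y → x * x + y * y ≡ 0ℚ → x ≡ 0ℚ × y ≡ 0ℚ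
sum-of-squares-zero x y eq = first x y eq , first y x (trans (ℚ.+-comm (y * y) (x * x)) eq)
  where
  first : ∀ x y → x * x + y * y ≡ 0ℚ → x ≡ 0ℚ
  first x y eq = square-zero (ℚ.≤-antisym
    (subst₂ _≤_ (ℚ.+-identityʳ (x * x)) eq (ℚ.+-monoʳ-≤ (x * x) (square-nonNegative y)))
    (square-nonNegative x))

square-one : ∀ {x} → x * x ≡ 1ℚ → x ≡ 1ℚ ⊎ x ≡ - 1ℚ
square-one {x} xx≡1 with x ℚ.≟ 1ℚ
... | yes x≡1 = inj₁ x≡1
... | no  x≢1 = inj₂ (trans (lemma₂ x) (cong (_- 1ℚ) (*-cancelʳ-0 {x + 1ℚ} x-1≢0 product)))
  where
  lemma₁ : ∀ x → (x + 1ℚ) * (x - 1ℚ) ≡ x * x - 1ℚ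
  lemma₁ = solve-∀ ℚ-ring
  lemma₂ : ∀ x → x ≡ x + 1ℚ - 1ℚ
  lemma₂ = solve-∀ ℚ-ring
  lemma₃ : ∀ x → x ≡ x - 1ℚ + 1ℚ
  lemma₃ = solve-∀ ℚ-ring
  x-1≢0 : x - 1ℚ ≢ 0ℚ
  x-1≢0 eq = x≢1 (trans (lemma₃ x) (cong (_+ 1ℚ) eq))
  product : (x + 1ℚ) * (x - 1ℚ) ≡ 0ℚ
  product = trans (lemma₁ x) (cong (_- 1ℚ) xx≡1)

halve : ∀ x → ∃[ h ] h + h ≡ x
halve x = ½ * x , lemma x
  where
  lemma : ∀ x → ½ * x + ½ * x ≡ x
  lemma = solve-∀ ℚ-ring

-- Unit intervals

lower-end : ∀ i → InUnitInterval i (i / 1)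
lower-end i = ℚ.≤-refl , subst (i / 1 ≤_) (sym (/1-homo-+ i (+ 1)))
  (subst (_≤ i / 1 + 1ℚ) (ℚ.+-identityʳ (i / 1)) (ℚ.+-monoʳ-≤ (i / 1) (ℚ.nonNegative⁻¹ 1ℚ)))

1∈interval : InUnitInterval (+ 0) 1ℚ
1∈interval = ℚ.nonNegative⁻¹ 1ℚ , ℚ.≤-refl

-- Each lower end lies in its own interval, hence in the other one, and this bounds the indices both
-- ways.
interval-injective : ∀ {i j} → (∀ x → InUnitInterval i x → InUnitInterval j x) →
  (∀ x → InUnitInterval j x → InUnitInterval i x) → i ≡ j
interval-injective {i} {j} i⊆j j⊆i = ℤ.≤-antisym
  (/1-cancel-≤ (proj₁ (j⊆i _ (lower-end j)))) (/1-cancel-≤ (proj₁ (i⊆j _ (lower-end i))))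

-- Intervals are closed, so `i + 1` still belongs to the one of index `i`; `i + 2` is the first
-- integer beyond it.
i+2∉interval : ∀ i → ¬ InUnitInterval i ((i ℤ.+ + 2) / 1)
i+2∉interval i (_ , p) = ℤ.<⇒≱ (ℤ.+-monoʳ-< i (ℤ.+<+ (ℕ.n<1+n 1))) (/1-cancel-≤ p)

-- An affine function of non-zero slope takes every value, in particular one outside the interval.
-- This makes entries of the linear part of an isometry vanish.
bounded⇒constant : ∀ k u s → (∀ x → InUnitInterval k (u + x * s)) → s ≡ 0ℚ
bounded⇒constant k u s bounded with s ℚ.≟ 0ℚ
... | yes s≡0 = s≡0
... | no  s≢0 = contradiction (subst (InUnitInterval k) eq (bounded ((v - u) * 1/ s))) (i+2∉interval k)
  where
  instance _ = ≢-nonZero s≢0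
  v = (k ℤ.+ + 2) / 1
  eq : u + (v - u) * 1/ s * s ≡ v
  eq = begin
    u + (v - u) * 1/ s * s    ≡⟨ cong (λ t → u + t) (ℚ.*-assoc (v - u) (1/ s) s) ⟩
    u + (v - u) * (1/ s * s)  ≡⟨ cong (λ t → u + (v - u) * t) (ℚ.*-inverseˡ s) ⟩
    u + (v - u) * 1ℚ          ≡⟨ lemma u v ⟩
    v                         ∎
    where
    open ≡-Reasoning
    lemma : ∀ u v → u + (v - u) * 1ℚ ≡ v
    lemma = solve-∀ ℚ-ring

-- Isometries of the line that permute the unit intervals

data Move : Set where
  shift flip : ℤ → Move

-- The offset of a flip is such that the interval of index i goes to the one of
-- index b - i.
offset : Move → ℚ
offset (shift b) = b / 1
offset (flip b)  = (b ℤ.+ + 1) / 1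

move : Move → ℚ → ℚ
move a@(shift _) x = x + offset a
move a@(flip _)  x = offset a - x

index : Move → ℤ → ℤ
index (shift b) i = i ℤ.+ b
index (flip b)  i = b ℤ.- i

inverse : Move → Move
inverse (shift b) = shift (ℤ.- b)
inverse (flip b)  = flip b

move-inverse : ∀ a x → move a (move (inverse a) x) ≡ x
move-inverse (shift b) x = trans (cong (λ t → x + t + b / 1) (/1-homo-neg b)) (lemma x (b / 1))
  where
  lemma : ∀ x y → x - y + y ≡ x
  lemma = solve-∀ ℚ-ring
move-inverse (flip b) x = lemma x ((b ℤ.+ + 1) / 1)
  where
  lemma : ∀ x y → y - (y - x) ≡ x
  lemma = solve-∀ ℚ-ring

index-inverseʳ : ∀ a i → index a (index (inverse a) i) ≡ i
index-inverseʳ (shift b) i = lemma i b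
  where
  lemma : ∀ i b → i ℤ.- b ℤ.+ b ≡ i
  lemma = ℤ-Ring.solve-∀
index-inverseʳ (flip b) i = lemma i b
  where
  lemma : ∀ i b → b ℤ.- (b ℤ.- i) ≡ i
  lemma = ℤ-Ring.solve-∀

index-inverseˡ : ∀ a i → index (inverse a) (index a i) ≡ i
index-inverseˡ (shift b) i = lemma i b
  where
  lemma : ∀ i b → i ℤ.+ b ℤ.- b ≡ i
  lemma = ℤ-Ring.solve-∀
index-inverseˡ (flip b) i = index-inverseʳ (flip b) i

move-interval : ∀ a {i x} → InUnitInterval i x → InUnitInterval (index a i) (move a x)
move-interval (shift b) {i} {x} (i≤x , x≤i+1) =
  subst (_≤ x + b / 1) (sym (/1-homo-+ i b)) (ℚ.+-monoˡ-≤ (b / 1) i≤x) ,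
  subst (x + b / 1 ≤_) (trans (sym (/1-homo-+ (i ℤ.+ + 1) b)) (cong (_/ 1) (lemma i b)))
    (ℚ.+-monoˡ-≤ (b / 1) x≤i+1)
  where
  lemma : ∀ i b → i ℤ.+ + 1 ℤ.+ b ≡ i ℤ.+ b ℤ.+ + 1
  lemma = ℤ-Ring.solve-∀
move-interval (flip b) {i} {x} (i≤x , x≤i+1) =
  subst (_≤ B - x) (trans (difference (i ℤ.+ + 1)) (cong (_/ 1) (lemma₁ i b)))
    (ℚ.+-monoʳ-≤ B (ℚ.neg-antimono-≤ x≤i+1)) ,
  subst (B - x ≤_) (trans (difference i) (cong (_/ 1) (lemma₂ i b)))
    (ℚ.+-monoʳ-≤ B (ℚ.neg-antimono-≤ i≤x))
  where
  B = (b ℤ.+ + 1) / 1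
  difference : ∀ j → B - j / 1 ≡ (b ℤ.+ + 1 ℤ.- j) / 1
  difference j = trans (cong (λ t → B + t) (sym (/1-homo-neg j))) (sym (/1-homo-+ (b ℤ.+ + 1) (ℤ.- j)))
  lemma₁ : ∀ i b → b ℤ.+ + 1 ℤ.- (i ℤ.+ + 1) ≡ b ℤ.- i
  lemma₁ = ℤ-Ring.solve-∀
  lemma₂ : ∀ i b → b ℤ.+ + 1 ℤ.- i ≡ b ℤ.- i ℤ.+ + 1
  lemma₂ = ℤ-Ring.solve-∀

move-interval⁻¹ : ∀ a {i x} → InUnitInterval (index a i) x → InUnitInterval i (move (inverse a) x)
move-interval⁻¹ a {i} {x} p =
  subst (λ j → InUnitInterval j (move (inverse a) x)) (index-inverseˡ a i) (move-interval (inverse a) p)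

move-leaves-interval : ∀ a k → ∃[ x ] ¬ InUnitInterval k (move a x)
move-leaves-interval a k =
  move (inverse a) ((k ℤ.+ + 2) / 1) ,
  λ p → i+2∉interval k (subst (InUnitInterval k) (move-inverse a _) p)

move-distance : ∀ a x y → (move a x - move a y) * (move a x - move a y) ≡ (x - y) * (x - y)
move-distance (shift b) x y = lemma x y (b / 1)
  where
  lemma : ∀ x y b → (x + b - (y + b)) * (x + b - (y + b)) ≡ (x - y) * (x - y)
  lemma = solve-∀ ℚ-ring
move-distance (flip b) x y = lemma x y ((b ℤ.+ + 1) / 1)
  where
  lemma : ∀ x y b → (b - x - (b - y)) * (b - x - (b - y)) ≡ (x - y) * (x - y)
  lemma = solve-∀ ℚ-ring

-- The slope is 1 or -1, and the two ends of the interval of index 0 pin `u` down. With slope 1 the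
-- point 0 gives `k ≤ u` and the point 1 gives `u ≤ k`; with slope -1 they give `u ≤ k + 1` and
-- `k + 1 ≤ u`.
unit-slope⇒move : ∀ k u s → s * s ≡ 1ℚ →
  (∀ x → InUnitInterval (+ 0) x → InUnitInterval k (u + x * s)) →
  ∃[ a ] (∀ x → u + x * s ≡ move a x) × index a (+ 0) ≡ k
unit-slope⇒move k u s ss≡1 into with square-one {s} ss≡1
... | inj₁ refl = shift k , (λ x → trans (lemma₁ u x) (cong (λ t → x + t) u≡k)) , ℤ.+-identityˡ k
  where
  lemma₁ : ∀ u x → u + x * 1ℚ ≡ x + u
  lemma₁ = solve-∀ ℚ-ring
  lemma₂ : ∀ u → u + 1ℚ * 1ℚ - 1ℚ ≡ u
  lemma₂ = solve-∀ ℚ-ring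
  lemma₃ : ∀ u → u + 1ℚ - 1ℚ ≡ u
  lemma₃ = solve-∀ ℚ-ring
  u≡k : u ≡ k / 1
  u≡k = ℚ.≤-antisym
    (subst₂ _≤_ (lemma₂ u) (trans (cong (_- 1ℚ) (/1-homo-+ k (+ 1))) (lemma₃ (k / 1)))
      (ℚ.+-monoˡ-≤ (- 1ℚ) (proj₂ (into 1ℚ 1∈interval))))
    (subst (k / 1 ≤_) (trans (lemma₁ u 0ℚ) (ℚ.+-identityˡ u)) (proj₁ (into 0ℚ (lower-end (+ 0)))))
... | inj₂ refl = flip k , (λ x → trans (lemma₁ u x) (cong (_- x) u≡k+1)) , ℤ.+-identityʳ k
  where
  lemma₁ : ∀ u x → u + x * - 1ℚ ≡ u - x
  lemma₁ = solve-∀ ℚ-ring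
  lemma₂ : ∀ u → u + 1ℚ * - 1ℚ + 1ℚ ≡ u
  lemma₂ = solve-∀ ℚ-ring
  u≡k+1 : u ≡ (k ℤ.+ + 1) / 1
  u≡k+1 = ℚ.≤-antisym
    (subst (_≤ (k ℤ.+ + 1) / 1) (trans (lemma₁ u 0ℚ) (ℚ.+-identityʳ u)) (proj₂ (into 0ℚ (lower-end (+ 0)))))
    (subst₂ _≤_ (sym (/1-homo-+ k (+ 1))) (lemma₂ u)
      (ℚ.+-monoˡ-≤ 1ℚ (proj₁ (into 1ℚ 1∈interval))))

-- Images of regions, and transposition

maps : ∀ {g S T} → MapsOnto g S T → ∀ {p} → S p → T (g p)
maps onto s = Equivalence.from (onto _) (_ , s , refl)

image-unique : ∀ {g S T T′} → MapsOnto g S T → MapsOnto g S T′ → ∀ q → T q → T′ q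
image-unique {T′ = T′} onto onto′ q t with Equivalence.to (onto q) t
... | p , s , eq = subst T′ eq (maps onto′ s)

-- Composition with this reflection in the main diagonal turns a map that exchanges warps and wefts
-- into one that preserves them, so that only the latter kind has to be analysed.
transpose : Plane → Plane
transpose (x , y) = y , x

transposeStrand : Strand → Strand
transposeStrand (warp i) = weft i
transposeStrand (weft i) = warp i

mapsOnto-transpose : ∀ {g S T} → MapsOnto g S T → MapsOnto (transpose ∘ g) S (T ∘ transpose)
mapsOnto-transpose onto q = mk⇔
  (λ t → let p , s , eq = Equivalence.to (onto _) t in p , s , cong transpose eq)
  (λ (p , s , eq) → Equivalence.from (onto _) (p , s , cong transpose eq))

mapsOnto-transposeStrand : ∀ {g S} t → MapsOnto g S (strandRegion t) →
  MapsOnto (transpose ∘ g) S (strandRegion (transposeStrand t))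
mapsOnto-transposeStrand (warp i) = mapsOnto-transpose
mapsOnto-transposeStrand (weft i) = mapsOnto-transpose

transpose-isometry : ∀ {g} → IsIsometry g → IsIsometry (transpose ∘ g)
transpose-isometry {g} isometry p q = trans
  (ℚ.+-comm ((y - y′) * (y - y′)) ((x - x′) * (x - x′))) (isometry p q)
  where
  x  = proj₁ (g p)
  y  = proj₂ (g p)
  x′ = proj₁ (g q)
  y′ = proj₂ (g q)

-- Maps that act on each coordinate by a move

record Aligned (g : Plane → Plane) (a b : Move) : Set where
  field
    acts : ∀ x y → g (x , y) ≡ (move a x , move b y)

-- `MapsOnto` asks for a preimage of every point of `T`; the inverse moves provide it.
aligned-mapsOnto : ∀ {g a b S T} → Aligned g a b →
  (∀ x y → S (x , y) → T (move a x , move b y)) →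
  (∀ x y → T (x , y) → S (move (inverse a) x , move (inverse b) y)) →
  MapsOnto g S T
aligned-mapsOnto {a = a} {b} {T = T} aligned into back (x , y) = mk⇔
  (λ t → _ , back x y t , trans (acts _ _) (cong₂ _,_ (move-inverse a x) (move-inverse b y)))
  (λ ((x′ , y′) , s , eq) → subst T (trans (sym (acts x′ y′)) eq) (into x′ y′ s))
  where open Aligned aligned

aligned-warp : ∀ {g a b} → Aligned g a b → ∀ i →
  MapsOnto g (strandRegion (warp i)) (strandRegion (warp (index a i)))
aligned-warp {a = a} aligned i =
  aligned-mapsOnto aligned (λ _ _ → move-interval a) (λ _ _ → move-interval⁻¹ a)

aligned-weft : ∀ {g a b} → Aligned g a b → ∀ j →
  MapsOnto g (strandRegion (weft j)) (strandRegion (weft (index b j)))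
aligned-weft {b = b} aligned j =
  aligned-mapsOnto aligned (λ _ _ → move-interval b) (λ _ _ → move-interval⁻¹ b)

aligned-cell : ∀ {g a b} → Aligned g a b → ∀ i j →
  MapsOnto g (cellRegion (i , j)) (cellRegion (index a i , index b j))
aligned-cell {a = a} {b} aligned i j = aligned-mapsOnto aligned
  (λ _ _ (x , y) → move-interval a x , move-interval b y)
  (λ _ _ (x , y) → move-interval⁻¹ a x , move-interval⁻¹ b y)

cellRegion-injective : ∀ {s t} → (∀ p → cellRegion s p → cellRegion t p) →
  (∀ p → cellRegion t p → cellRegion s p) → s ≡ t
cellRegion-injective {i , j} {i′ , j′} s⊆t t⊆s = cong₂ _,_
  -- The other coordinate stays at the lower end of its interval, so that inclusion of cells
  -- restricts to inclusion of intervals.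
  (interval-injective (λ x x∈ → proj₁ (s⊆t (x , j / 1) (x∈ , lower-end j)))
                      (λ x x∈ → proj₁ (t⊆s (x , j′ / 1) (x∈ , lower-end j′))))
  (interval-injective (λ y y∈ → proj₂ (s⊆t (i / 1 , y) (lower-end i , y∈)))
                      (λ y y∈ → proj₂ (t⊆s (i′ / 1 , y) (lower-end i′ , y∈))))

-- A warp is unbounded in the second coordinate and a move is onto, so some point of the warp is
-- carried out of the weft.
aligned-warp≢weft : ∀ {g a b i k} → Aligned g a b →
  ¬ MapsOnto g (strandRegion (warp i)) (strandRegion (weft k))
aligned-warp≢weft {b = b} {i} {k} aligned onto with move-leaves-interval b k
... | y , off = off (subst (λ q → strandRegion (weft k) q) (Aligned.acts aligned (i / 1) y) (maps onto (lower-end i)))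

aligned-weft≢warp : ∀ {g a b j k} → Aligned g a b →
  ¬ MapsOnto g (strandRegion (weft j)) (strandRegion (warp k))
aligned-weft≢warp {a = a} {j = j} {k} aligned onto with move-leaves-interval a k
... | x , off = off (subst (λ q → strandRegion (warp k) q) (Aligned.acts aligned x (j / 1)) (maps onto (lower-end j)))

-- Symmetries as equations between colours

recolour : Side → Colour → Colour
recolour e c    = c
recolour τ dark = pale
recolour τ pale = dark

recolour-injective : ∀ ε {c d} → recolour ε c ≡ recolour ε d → c ≡ d
recolour-injective e eq = eq
recolour-injective τ {dark} {dark} eq = refl
recolour-injective τ {pale} {pale} eq = refl

-- Naming a strand by a colour makes `upper` and `lower` one function up to `recolour`.
strandAt : Colour → Cell → Strand
strandAt dark (i , j) = warp i
strandAt pale (i , j) = weft j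

visible-strandAt : ∀ ε c i j → visible ε c (i , j) ≡ strandAt (recolour ε (c i j)) (i , j)
visible-strandAt e c i j with c i j
... | dark = refl
... | pale = refl
visible-strandAt τ c i j with c i j
... | dark = refl
... | pale = refl

transposeStrand-strandAt : ∀ c i j →
  transposeStrand (strandAt c (i , j)) ≡ strandAt (recolour τ c) (j , i)
transposeStrand-strandAt dark i j = refl
transposeStrand-strandAt pale i j = refl

aligned-strandAt : ∀ {g a b} → Aligned g a b → ∀ c i j →
  MapsOnto g (strandRegion (strandAt c (i , j))) (strandRegion (strandAt c (index a i , index b j)))
aligned-strandAt aligned dark i j = aligned-warp aligned i
aligned-strandAt aligned pale i j = aligned-weft aligned j

aligned-strandAt-injective : ∀ {g a b} → Aligned g a b → ∀ c d s t →
  MapsOnto g (strandRegion (strandAt c s)) (strandRegion (strandAt d t)) → d ≡ c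
aligned-strandAt-injective aligned dark dark s t onto = refl
aligned-strandAt-injective aligned dark pale s t onto = contradiction onto (aligned-warp≢weft {i = proj₁ s} {k = proj₂ t} aligned)
aligned-strandAt-injective aligned pale dark s t onto = contradiction onto (aligned-weft≢warp {j = proj₂ s} {k = proj₁ t} aligned)
aligned-strandAt-injective aligned pale pale s t onto = refl

-- An aligned map preserves the direction of strands, and the colour of a cell records the direction
-- of its uppermost strand; so the geometric condition `sides` becomes an equation between colours.
aligned-colours : ∀ {c g ε a b} → IsSymmetry c g ε → Aligned g a b →
  ∀ i j → recolour ε (c (index a i) (index b j)) ≡ c i j
aligned-colours {c} {g} {ε} {a} {b} symmetry aligned i j = aligned-strandAt-injective aligned _ _ (i , j) (index a i , index b j)
  (subst₂ (λ s t → MapsOnto g (strandRegion s) (strandRegion t))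
    (visible-strandAt e c i j) (visible-strandAt ε c (index a i) (index b j))
    (IsSymmetry.sides symmetry (i , j) _ (aligned-cell aligned i j)))

-- Here `g` itself takes the cell `(i , j)` to `(index b j , index a i)`. Transposing back exchanges
-- the directions, which accounts for the additional `recolour τ`.
transposed-colours : ∀ {c g ε a b} → IsSymmetry c g ε → Aligned (transpose ∘ g) a b →
  ∀ i j → recolour τ (recolour ε (c (index b j) (index a i))) ≡ c i j
transposed-colours {c} {g} {ε} {a} {b} symmetry aligned i j = aligned-strandAt-injective aligned _ _ (i , j) (index a i , index b j)
  (subst₂ (λ s t → MapsOnto (transpose ∘ g) (strandRegion s) (strandRegion t))
    (visible-strandAt e c i j)
    (trans (cong transposeStrand (visible-strandAt ε c (index b j) (index a i)))
           (transposeStrand-strandAt _ (index b j) (index a i)))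
    (mapsOnto-transposeStrand _
      (IsSymmetry.sides symmetry (i , j) (index b j , index a i)
        (mapsOnto-transposed (aligned-cell aligned i j)))))
  where
  mapsOnto-transposed : MapsOnto (transpose ∘ g) (cellRegion (i , j)) (cellRegion (index a i , index b j)) →
    MapsOnto g (cellRegion (i , j)) (cellRegion (index b j , index a i))
  mapsOnto-transposed onto q = mk⇔
    (λ (y , x) → Equivalence.to (mapsOnto-transpose onto q) (x , y))
    (λ image → let x , y = Equivalence.from (mapsOnto-transpose onto q) image in y , x)

alignedMap : Move → Move → Plane → Plane
alignedMap a b (x , y) = move a x , move b y

-- The converse of `aligned-colours`; it will turn the halved map into a symmetry of the original
-- prefabric.
alignedMap-symmetry : ∀ {c ε} a b → (∀ i j → recolour ε (c (index a i) (index b j)) ≡ c i j) →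
  IsSymmetry c (alignedMap a b) ε
alignedMap-symmetry {c} {ε} a b colours = record
  { isometry = λ (x , y) (x′ , y′) → cong₂ _+_ (move-distance a x x′) (move-distance b y y′)
  ; strands  = λ { (warp i) → warp (index a i) , aligned-warp aligned i
                 ; (weft j) → weft (index b j) , aligned-weft aligned j }
  ; sides    = sides
  }
  where
  aligned : Aligned (alignedMap a b) a b
  aligned = record { acts = λ x y → refl }
  sides : ∀ s t → MapsOnto (alignedMap a b) (cellRegion s) (cellRegion t) →
    MapsOnto (alignedMap a b) (strandRegion (upper c s)) (strandRegion (visible ε c t))
  -- An image is unique and a cell is determined by its region, so `t` can only be the cell computed
  -- from the indices.
  sides (i , j) t onto with cellRegion-injective {t} {index a i , index b j}
    (image-unique onto (aligned-cell aligned i j)) (image-unique (aligned-cell aligned i j) onto)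
  ... | refl = subst₂ (λ s t → MapsOnto (alignedMap a b) (strandRegion s) (strandRegion t))
    (sym (visible-strandAt e c i j))
    (sym (trans (visible-strandAt ε c (index a i) (index b j))
                (cong (λ d → strandAt d (index a i , index b j)) (colours i j))))
    (aligned-strandAt aligned (c i j) i j)

-- Isometries are affine with orthonormal linear part

-- The left-hand side of the conclusion is a polynomial combination of the
-- left-hand sides of the hypotheses.
orthonormal-expansion : ∀ {X Y a₁ a₂ b₁ b₂} x y →
  a₁ * a₁ + a₂ * a₂ ≡ 1ℚ → b₁ * b₁ + b₂ * b₂ ≡ 1ℚ → a₁ * b₁ + a₂ * b₂ ≡ 0ℚ →
  X * X + Y * Y ≡ x * x + y * y →
  (X - a₁) * (X - a₁) + (Y - a₂) * (Y - a₂) ≡ (x - 1ℚ) * (x - 1ℚ) + y * y →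
  (X - b₁) * (X - b₁) + (Y - b₂) * (Y - b₂) ≡ x * x + (y - 1ℚ) * (y - 1ℚ) →
  (X - (x * a₁ + y * b₁)) * (X - (x * a₁ + y * b₁)) + (Y - (x * a₂ + y * b₂)) * (Y - (x * a₂ + y * b₂)) ≡ 0ℚ
orthonormal-expansion {X} {Y} {a₁} {a₂} {b₁} {b₂} x y a-unit b-unit orthogonal norm a-distance b-distance =
  trans (expand X Y a₁ a₂ b₁ b₂ x y) (substitute a-unit b-unit orthogonal norm a-distance b-distance)
  where
  combination : (α β γ ν δ ε : ℚ) → ℚ
  combination α β γ ν δ ε =
    ν + x * x * α + y * y * β - x * (ν + α - δ) - y * (ν + β - ε) + (x * y + x * y) * γ
  expand : ∀ X Y a c b d x y →
    (X - (x * a + y * b)) * (X - (x * a + y * b)) + (Y - (x * c + y * d)) * (Y - (x * c + y * d)) ≡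
    (X * X + Y * Y) + x * x * (a * a + c * c) + y * y * (b * b + d * d)
      - x * ((X * X + Y * Y) + (a * a + c * c) - ((X - a) * (X - a) + (Y - c) * (Y - c)))
      - y * ((X * X + Y * Y) + (b * b + d * d) - ((X - b) * (X - b) + (Y - d) * (Y - d)))
      + (x * y + x * y) * (a * b + c * d)
  expand = solve-∀ ℚ-ring
  cancel : ∀ x y →
    (x * x + y * y) + x * x * 1ℚ + y * y * 1ℚ
      - x * ((x * x + y * y) + 1ℚ - ((x - 1ℚ) * (x - 1ℚ) + y * y))
      - y * ((x * x + y * y) + 1ℚ - (x * x + (y - 1ℚ) * (y - 1ℚ)))
      + (x * y + x * y) * 0ℚ ≡ 0ℚ
  cancel = solve-∀ ℚ-ring
  substitute : ∀ {α β γ ν δ ε} → α ≡ 1ℚ → β ≡ 1ℚ → γ ≡ 0ℚ → ν ≡ x * x + y * y →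
    δ ≡ (x - 1ℚ) * (x - 1ℚ) + y * y → ε ≡ x * x + (y - 1ℚ) * (y - 1ℚ) → combination α β γ ν δ ε ≡ 0ℚ
  substitute refl refl refl refl refl refl = cancel x y

difference : ∀ x y o → x - o - (y - o) ≡ x - y
difference = solve-∀ ℚ-ring

-- The polarisation identity: three lengths determine the inner product. The value 2 is the squared
-- distance between the two unit points.
polarise : ∀ {a₁ a₂ b₁ b₂} → a₁ * a₁ + a₂ * a₂ ≡ 1ℚ → b₁ * b₁ + b₂ * b₂ ≡ 1ℚ →
  (a₁ - b₁) * (a₁ - b₁) + (a₂ - b₂) * (a₂ - b₂) ≡ 1ℚ + 1ℚ → a₁ * b₁ + a₂ * b₂ ≡ 0ℚ
polarise {a₁} {a₂} {b₁} {b₂} a-unit b-unit distance =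
  trans (lemma a₁ a₂ b₁ b₂) (substitute a-unit b-unit distance)
  where
  lemma : ∀ a₁ a₂ b₁ b₂ → a₁ * b₁ + a₂ * b₂ ≡
    ½ * ((a₁ * a₁ + a₂ * a₂) + (b₁ * b₁ + b₂ * b₂) - ((a₁ - b₁) * (a₁ - b₁) + (a₂ - b₂) * (a₂ - b₂)))
  lemma = solve-∀ ℚ-ring
  substitute : ∀ {α β δ} → α ≡ 1ℚ → β ≡ 1ℚ → δ ≡ 1ℚ + 1ℚ → ½ * (α + β - δ) ≡ 0ℚ
  substitute refl refl refl = refl

record OrthonormalForm (g : Plane → Plane) : Set where
  field
    o₁ o₂ a₁ a₂ b₁ b₂ : ℚ
    a-unit     : a₁ * a₁ + a₂ * a₂ ≡ 1ℚ
    b-unit     : b₁ * b₁ + b₂ * b₂ ≡ 1ℚ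
    orthogonal : a₁ * b₁ + a₂ * b₂ ≡ 0ℚ
    affine     : ∀ x y → g (x , y) ≡ (o₁ + x * a₁ + y * b₁ , o₂ + x * a₂ + y * b₂)

-- The candidate is the affine map that agrees with `g` at the origin and at the two unit points.
-- The squared distance between its value and that of `g` at `(x , y)` is computed from distances
-- that `g` preserves, and is zero.
isometry⇒orthonormal : ∀ {g} → IsIsometry g → OrthonormalForm g
isometry⇒orthonormal {g} isometry = record
  { o₁ = o₁ ; o₂ = o₂ ; a₁ = a₁ ; a₂ = a₂ ; b₁ = b₁ ; b₂ = b₂
  ; a-unit = a-unit ; b-unit = b-unit ; orthogonal = orthogonal ; affine = affine }
  where
  o₁ o₂ a₁ a₂ b₁ b₂ : ℚ
  o₁ = proj₁ (g 𝟎)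
  o₂ = proj₂ (g 𝟎)
  a₁ = proj₁ (g (1ℚ , 0ℚ)) - o₁
  a₂ = proj₂ (g (1ℚ , 0ℚ)) - o₂
  b₁ = proj₁ (g (0ℚ , 1ℚ)) - o₁
  b₂ = proj₂ (g (0ℚ , 1ℚ)) - o₂

  a-unit : a₁ * a₁ + a₂ * a₂ ≡ 1ℚ
  a-unit = isometry (1ℚ , 0ℚ) 𝟎

  b-unit : b₁ * b₁ + b₂ * b₂ ≡ 1ℚ
  b-unit = isometry (0ℚ , 1ℚ) 𝟎

  relative-distance : ∀ p q →
    (proj₁ (g p) - o₁ - (proj₁ (g q) - o₁)) * (proj₁ (g p) - o₁ - (proj₁ (g q) - o₁)) +
    (proj₂ (g p) - o₂ - (proj₂ (g q) - o₂)) * (proj₂ (g p) - o₂ - (proj₂ (g q) - o₂)) ≡ dist² p q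
  relative-distance p q = trans
    (cong₂ (λ s t → s * s + t * t)
      (difference (proj₁ (g p)) (proj₁ (g q)) o₁) (difference (proj₂ (g p)) (proj₂ (g q)) o₂))
    (isometry p q)

  orthogonal : a₁ * b₁ + a₂ * b₂ ≡ 0ℚ
  orthogonal = polarise {a₁} {a₂} {b₁} {b₂} a-unit b-unit (relative-distance (1ℚ , 0ℚ) (0ℚ , 1ℚ))

  affine : ∀ x y → g (x , y) ≡ (o₁ + x * a₁ + y * b₁ , o₂ + x * a₂ + y * b₂)
  affine x y = cong₂ _,_
    (coordinate (proj₁ (g (x , y))) o₁ (x * a₁) (y * b₁) (proj₁ zero))
    (coordinate (proj₂ (g (x , y))) o₂ (x * a₂) (y * b₂) (proj₂ zero))
    where
    X = proj₁ (g (x , y)) - o₁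
    Y = proj₂ (g (x , y)) - o₂
    minus-zero : ∀ x → x - 0ℚ ≡ x
    minus-zero = ℚ.+-identityʳ
    zero : X - (x * a₁ + y * b₁) ≡ 0ℚ × Y - (x * a₂ + y * b₂) ≡ 0ℚ
    zero = sum-of-squares-zero (X - (x * a₁ + y * b₁)) (Y - (x * a₂ + y * b₂))
      (orthonormal-expansion {X} {Y} {a₁} {a₂} {b₁} {b₂} x y a-unit b-unit orthogonal
        (trans (isometry (x , y) 𝟎) (cong₂ (λ s t → s * s + t * t) (minus-zero x) (minus-zero y)))
        (trans (relative-distance (x , y) (1ℚ , 0ℚ)) (cong (λ t → (x - 1ℚ) * (x - 1ℚ) + t * t) (minus-zero y)))
        (trans (relative-distance (x , y) (0ℚ , 1ℚ)) (cong (λ t → t * t + (y - 1ℚ) * (y - 1ℚ)) (minus-zero x))))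
    coordinate : ∀ z o u v → z - o - (u + v) ≡ 0ℚ → z ≡ o + u + v
    coordinate z o u v eq = trans (lemma z o u v) (trans (cong (_+ (o + u + v)) eq) (ℚ.+-identityˡ (o + u + v)))
      where
      lemma : ∀ z o u v → z ≡ z - o - (u + v) + (o + u + v)
      lemma = solve-∀ ℚ-ring

-- From the action on strands to moves of the coordinates

-- Along a vertical line in warp 0 the first coordinate of the image stays bounded, so `b₁`
-- vanishes. Orthonormality then makes `a₂` vanish and leaves `a₁` and `b₂` with square 1.
strand-preserving⇒aligned : ∀ {g} → OrthonormalForm g → ∀ k →
  (∀ p → strandRegion (warp (+ 0)) p → strandRegion (warp k) (g p)) →
  (t : Strand) → (∀ p → strandRegion (weft (+ 0)) p → strandRegion t (g p)) →
  ∃[ a ] ∃[ b ] Aligned g a b × index a (+ 0) ≡ k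
strand-preserving⇒aligned {g} form k warp-into t weft-into = conclude t weft-into
  where
  open OrthonormalForm form

  b₁≡0 : b₁ ≡ 0ℚ
  b₁≡0 = bounded⇒constant k o₁ b₁ (λ y → subst (InUnitInterval k)
    (trans (cong proj₁ (affine 0ℚ y)) (lemma o₁ a₁ (y * b₁)))
    (warp-into (0ℚ , y) (lower-end (+ 0))))
    where
    lemma : ∀ o a v → o + 0ℚ * a + v ≡ o + v
    lemma = solve-∀ ℚ-ring

  b₂-unit : b₂ * b₂ ≡ 1ℚ
  b₂-unit = trans (sym (trans (cong (λ t → t * t + b₂ * b₂) b₁≡0) (lemma b₂))) b-unit
    where
    lemma : ∀ b → 0ℚ * 0ℚ + b * b ≡ b * b
    lemma = solve-∀ ℚ-ring

  a₂≡0 : a₂ ≡ 0ℚ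
  a₂≡0 = *-cancelʳ-0 b₂≢0 (trans (sym (trans (cong (λ t → a₁ * t + a₂ * b₂) b₁≡0) (lemma a₁ (a₂ * b₂)))) orthogonal)
    where
    lemma : ∀ a v → a * 0ℚ + v ≡ v
    lemma = solve-∀ ℚ-ring
    b₂≢0 : b₂ ≢ 0ℚ
    b₂≢0 eq = ℚ.1≢0 (trans (sym b₂-unit) (trans (cong (_* b₂) eq) (ℚ.*-zeroˡ b₂)))

  a₁-unit : a₁ * a₁ ≡ 1ℚ
  a₁-unit = trans (sym (trans (cong (λ t → a₁ * a₁ + t * t) a₂≡0) (lemma a₁))) a-unit
    where
    lemma : ∀ a → a * a + 0ℚ * 0ℚ ≡ a * a
    lemma = solve-∀ ℚ-ring

  first : ∀ x y → proj₁ (g (x , y)) ≡ o₁ + x * a₁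
  first x y = trans (cong proj₁ (affine x y)) (trans (cong (λ t → o₁ + x * a₁ + y * t) b₁≡0) (lemma (o₁ + x * a₁) y))
    where
    lemma : ∀ v y → v + y * 0ℚ ≡ v
    lemma = solve-∀ ℚ-ring

  second : ∀ x y → proj₂ (g (x , y)) ≡ o₂ + y * b₂
  second x y = trans (cong proj₂ (affine x y)) (trans (cong (λ t → o₂ + x * t + y * b₂) a₂≡0) (lemma o₂ x (y * b₂)))
    where
    lemma : ∀ o x v → o + x * 0ℚ + v ≡ o + v
    lemma = solve-∀ ℚ-ring

  conclude : (t : Strand) → (∀ p → strandRegion (weft (+ 0)) p → strandRegion t (g p)) →
    ∃[ a ] ∃[ b ] Aligned g a b × index a (+ 0) ≡ k
  -- A weft carried into a warp would keep the first coordinate bounded and force `a₁` to vanish,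
  -- though its square is 1.
  conclude (warp l) weft-into = contradiction
    (bounded⇒constant l o₁ a₁ (λ x → subst (InUnitInterval l) (first x 0ℚ) (weft-into (x , 0ℚ) (lower-end (+ 0)))))
    (λ a₁≡0 → ℚ.1≢0 (trans (sym a₁-unit) (trans (cong (_* a₁) a₁≡0) (ℚ.*-zeroˡ a₁))))
  conclude (weft l) weft-into =
    let a , a-moves , a-index = unit-slope⇒move k o₁ a₁ a₁-unit
          (λ x x∈ → subst (InUnitInterval k) (first x 0ℚ) (warp-into (x , 0ℚ) x∈))
        b , b-moves , _ = unit-slope⇒move l o₂ b₂ b₂-unit
          (λ y y∈ → subst (InUnitInterval l) (second 0ℚ y) (weft-into (0ℚ , y) y∈))
    in a , b , record
         { acts = λ x y → cong₂ _,_ (trans (first x y) (a-moves x)) (trans (second x y) (b-moves y)) }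
       , a-index

symmetry-warp : ∀ {c g ε k} → IsSymmetry c g ε → MapsOnto g (strandRegion (warp (+ 0))) (strandRegion (warp k)) →
  ∃[ a ] ∃[ b ] Aligned g a b × index a (+ 0) ≡ k
symmetry-warp {k = k} symmetry onto = strand-preserving⇒aligned (isometry⇒orthonormal isometry) k (λ p → maps onto {p}) _
  (λ p → maps (proj₂ (strands (weft (+ 0)))) {p})
  where open IsSymmetry symmetry

-- A point lies in a weft exactly when its transpose lies in the warp of the same index, so
-- `transpose ∘ g` takes warp 0 into a warp.
symmetry-weft : ∀ {c g ε k} → IsSymmetry c g ε → MapsOnto g (strandRegion (warp (+ 0))) (strandRegion (weft k)) →
  ∃[ a ] ∃[ b ] Aligned (transpose ∘ g) a b × index a (+ 0) ≡ k
symmetry-weft {g = g} {k = k} symmetry onto = strand-preserving⇒aligned (isometry⇒orthonormal (transpose-isometry {g} isometry)) k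
  (λ p → maps onto {p}) _
  (λ p → maps (mapsOnto-transposeStrand _ (proj₂ (strands (weft (+ 0))))) {p})
  where open IsSymmetry symmetry

-- Rotations and glide-reflections in coordinates

half-turn-rotation : ∀ {g} A B → (∀ x y → g (x , y) ≡ (A - x , B - y)) → IsRotation g
half-turn-rotation A B acts =
  let h , h+h≡A = halve A
      k , k+k≡B = halve B
  in record
  { centre = h , k
  ; cosine = - 1ℚ
  ; sine   = 0ℚ
  ; unit   = refl
  ; acts   = λ (x , y) → trans (acts x y) (cong₂ _,_
      (trans (cong (_- x) (sym h+h≡A)) (first h k x y)) (trans (cong (_- y) (sym k+k≡B)) (second h k x y)))
  }
  where
  first : ∀ h k x y → h + h - x ≡ h + (- 1ℚ * (x - h) - 0ℚ * (y - k))
  first = solve-∀ ℚ-ring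
  second : ∀ h k x y → k + k - y ≡ k + (0ℚ * (x - h) + - 1ℚ * (y - k))
  second = solve-∀ ℚ-ring

-- The centre is the fixed point: `x = B - y` and `y = x + A` give `x` as half of `B - A`.
quarter-turn-rotation : ∀ {g} A B → (∀ x y → g (x , y) ≡ (B - y , x + A)) → IsRotation g
quarter-turn-rotation A B acts =
  let h , h+h≡B-A = halve (B - A)
      B≡h+h+A     = sym (trans (cong (_+ A) h+h≡B-A) (cancel A B))
  in record
  { centre = h , h + A
  ; cosine = 0ℚ
  ; sine   = 1ℚ
  ; unit   = refl
  ; acts   = λ (x , y) → trans (acts x y) (cong₂ _,_
      (trans (cong (_- y) B≡h+h+A) (first h A x y)) (second h A x y))
  }
  where
  cancel : ∀ A B → B - A + A ≡ B
  cancel = solve-∀ ℚ-ring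
  first : ∀ h A x y → h + h + A - y ≡ h + (0ℚ * (x - h) - 1ℚ * (y - (h + A)))
  first = solve-∀ ℚ-ring
  second : ∀ h A x y → x + A ≡ h + A + (1ℚ * (x - h) + 0ℚ * (y - (h + A)))
  second = solve-∀ ℚ-ring

negative-quarter-turn-rotation : ∀ {g} A B → (∀ x y → g (x , y) ≡ (y + B , A - x)) → IsRotation g
negative-quarter-turn-rotation A B acts =
  let h , h+h≡A-B = halve (A - B)
      A≡h+h+B     = sym (trans (cong (_+ B) h+h≡A-B) (cancel A B))
  in record
  { centre = h + B , h
  ; cosine = 0ℚ
  ; sine   = - 1ℚ
  ; unit   = refl
  ; acts   = λ (x , y) → trans (acts x y) (cong₂ _,_
      (first h B x y) (trans (cong (_- x) A≡h+h+B) (second h B x y)))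
  }
  where
  cancel : ∀ A B → A - B + B ≡ A
  cancel = solve-∀ ℚ-ring
  first : ∀ h B x y → y + B ≡ h + B + (0ℚ * (x - (h + B)) - - 1ℚ * (y - h))
  first = solve-∀ ℚ-ring
  second : ∀ h B x y → h + h + B - x ≡ h + (- 1ℚ * (x - (h + B)) + 0ℚ * (y - h))
  second = solve-∀ ℚ-ring

-- The origin may be the centre, so non-triviality needs a second point: if the origin is fixed then
-- `A` is zero, and the first coordinate 1 becomes -1.
half-turn-moves : ∀ A → A - 0ℚ ≡ 0ℚ → A - 1ℚ ≢ 1ℚ
half-turn-moves A at-0 at-1 = contradiction
  (trans (sym at-1) (cong (_- 1ℚ) (trans (sym (ℚ.+-identityʳ A)) at-0))) (λ ())

quarter-turn-moves : ∀ B → B - 0ℚ ≡ 0ℚ → B - 1ℚ ≢ 0ℚ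
quarter-turn-moves B at-0 at-1 = contradiction
  (trans (sym at-1) (cong (_- 1ℚ) (trans (sym (ℚ.+-identityʳ B)) at-0))) (λ ())

negative-quarter-turn-moves : ∀ B → 0ℚ + B ≡ 0ℚ → 1ℚ + B ≢ 0ℚ
negative-quarter-turn-moves B at-0 at-1 = contradiction
  (trans (sym at-1) (cong (λ t → 1ℚ + t) (trans (sym (ℚ.+-identityˡ B)) at-0))) (λ ())

diagonal antidiagonal vertical : Plane → Line
diagonal o     = record { point = o ; direction = 1ℚ , 1ℚ ; direction≢𝟎 = λ () }
antidiagonal o = record { point = o ; direction = 1ℚ , - 1ℚ ; direction≢𝟎 = λ () }
vertical o     = record { point = o ; direction = 0ℚ , 1ℚ ; direction≢𝟎 = λ () }

-- The component of the translation `(B , A)` along the direction `(1 , 1)` is `h` times that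
-- direction, with `h` half of `A + B`. The remaining component displaces the axis, which meets the
-- horizontal coordinate axis at `B - h`.
diagonal-glide : ∀ {g} A B → (∀ x y → g (x , y) ≡ (y + B , x + A)) → ∃[ o ] HasAxis g (diagonal o)
diagonal-glide A B acts =
  let h , h+h≡A+B = halve (A + B)
      A≡h+h-B     = sym (trans (cong (_- B) h+h≡A+B) (cancel A B))
  in (B - h , 0ℚ) , h , λ x y → trans (acts _ _) (cong₂ _,_
    (first h B x y) (trans (cong (λ t → B - h + x * 1ℚ + y * - 1ℚ + t) A≡h+h-B) (second h B x y)))
  where
  cancel : ∀ A B → A + B - B ≡ A
  cancel = solve-∀ ℚ-ring
  first : ∀ h B x y → 0ℚ + x * 1ℚ + y * 1ℚ + B ≡ B - h + (x + h) * 1ℚ - y * - 1ℚ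
  first = solve-∀ ℚ-ring
  second : ∀ h B x y → B - h + x * 1ℚ + y * - 1ℚ + (h + h - B) ≡ 0ℚ + (x + h) * 1ℚ - y * 1ℚ
  second = solve-∀ ℚ-ring

-- As for the diagonal, but the component of `(B , A)` along `(1 , - 1)` has coefficient half of
-- `B - A`.
antidiagonal-glide : ∀ {g} A B → (∀ x y → g (x , y) ≡ (B - y , A - x)) → ∃[ o ] HasAxis g (antidiagonal o)
antidiagonal-glide A B acts =
  let h , h+h≡B-A = halve (B - A)
      A≡B-[h+h]   = sym (trans (cong (λ t → B - t) h+h≡B-A) (cancel A B))
  in (B - h , 0ℚ) , h , λ x y → trans (acts _ _) (cong₂ _,_
    (first h B x y) (trans (cong (λ t → t - (B - h + x * 1ℚ + y * 1ℚ)) A≡B-[h+h]) (second h B x y)))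
  where
  cancel : ∀ A B → B - (B - A) ≡ A
  cancel = solve-∀ ℚ-ring
  first : ∀ h B x y → B - (0ℚ + x * - 1ℚ + y * 1ℚ) ≡ B - h + (x + h) * 1ℚ - y * 1ℚ
  first = solve-∀ ℚ-ring
  second : ∀ h B x y → B - (h + h) - (B - h + x * 1ℚ + y * 1ℚ) ≡ 0ℚ + (x + h) * - 1ℚ - y * 1ℚ
  second = solve-∀ ℚ-ring

vertical-glide : ∀ {g} A B → (∀ x y → g (x , y) ≡ (A - x , y + B)) → ∃[ o ] HasAxis g (vertical o)
vertical-glide A B acts =
  let h , h+h≡A = halve A
  in (h , 0ℚ) , B , λ x y → trans (acts _ _) (cong₂ _,_
    (trans (cong (λ t → t - (h + x * 0ℚ + y * - 1ℚ)) (sym h+h≡A)) (first h B x y)) (second B x y))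
  where
  first : ∀ h B x y → h + h - (h + x * 0ℚ + y * - 1ℚ) ≡ h + (x + B) * 0ℚ - y * - 1ℚ
  first = solve-∀ ℚ-ring
  second : ∀ B x y → 0ℚ + x * 1ℚ + y * 0ℚ + B ≡ 0ℚ + (x + B) * 1ℚ - y * 0ℚ
  second = solve-∀ ℚ-ring

-- Consequences of having only parallel axes

-- Two moves of the same kind give an oblique axis, two of different kinds a quarter-turn, which is
-- excluded. Of the direction only the first component is recorded: that it is not zero
-- distinguishes the axis from a vertical one.
strand-exchange-axis : ∀ {c g a b} → OnlyParallelAxes c → G₁ c g → Aligned (transpose ∘ g) a b →
  ∃[ ℓ ] HasAxis g ℓ × proj₁ (Line.direction ℓ) ≡ 1ℚ
strand-exchange-axis {g = g} {a} {b} axes g∈G₁ aligned =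
  cases a b (λ x y → cong transpose (Aligned.acts aligned x y))
  where
  cases : ∀ a b → (∀ x y → g (x , y) ≡ (move b y , move a x)) →
    ∃[ ℓ ] HasAxis g ℓ × proj₁ (Line.direction ℓ) ≡ 1ℚ
  cases a@(shift _) b@(shift _) acts =
    let o , axis = diagonal-glide (offset a) (offset b) acts in diagonal o , axis , refl
  cases a@(flip _) b@(flip _) acts =
    let o , axis = antidiagonal-glide (offset a) (offset b) acts in antidiagonal o , axis , refl
  cases a@(shift _) b@(flip _) acts = contradiction
    (quarter-turn-rotation (offset a) (offset b) acts , λ identity →
      quarter-turn-moves (offset b) (cong proj₁ (trans (sym (acts 0ℚ 0ℚ)) (identity (0ℚ , 0ℚ))))
                                    (cong proj₁ (trans (sym (acts 0ℚ 1ℚ)) (identity (0ℚ , 1ℚ)))))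
    (OnlyParallelAxes.noRotation axes g g∈G₁)
  cases a@(flip _) b@(shift _) acts = contradiction
    (negative-quarter-turn-rotation (offset a) (offset b) acts , λ identity →
      negative-quarter-turn-moves (offset b) (cong proj₁ (trans (sym (acts 0ℚ 0ℚ)) (identity (0ℚ , 0ℚ))))
                                             (cong proj₁ (trans (sym (acts 0ℚ 1ℚ)) (identity (0ℚ , 1ℚ)))))
    (OnlyParallelAxes.noRotation axes g g∈G₁)

-- A flip of the second coordinate as well would make `g` a half-turn; a shift makes its axis
-- vertical, against the oblique axis of `f`.
no-horizontal-flip : ∀ {c f g a b} m b′ → OnlyParallelAxes c → G₁ c f → Aligned (transpose ∘ f) a b →
  G₁ c g → ¬ Aligned g (flip m) b′
no-horizontal-flip {g = g} m b′@(flip _) axes f∈G₁ f-aligned g∈G₁ record { acts = acts } =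
  OnlyParallelAxes.noRotation axes g g∈G₁
    (half-turn-rotation (offset (flip m)) (offset b′) acts , λ identity →
      half-turn-moves (offset (flip m)) (cong proj₁ (trans (sym (acts 0ℚ 0ℚ)) (identity (0ℚ , 0ℚ))))
                                        (cong proj₁ (trans (sym (acts 1ℚ 0ℚ)) (identity (1ℚ , 0ℚ)))))
no-horizontal-flip {f = f} {g} m b′@(shift _) axes f∈G₁ f-aligned g∈G₁ record { acts = acts } =
  let ℓ , f-axis , d₁≡1 = strand-exchange-axis axes f∈G₁ f-aligned
      o , g-axis        = vertical-glide (offset (flip m)) (offset b′) acts
      r , parallel      = OnlyParallelAxes.parallel axes f g ℓ (vertical o) f∈G₁ g∈G₁ f-axis g-axis
      -- Being parallel says `(0 , 1) = r · (1 , d₂)`: the first components make `r` zero, the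
      -- second ones forbid it.
      r≡0 = trans (sym (ℚ.*-identityʳ r)) (trans (cong (r *_) (sym d₁≡1)) (sym (cong proj₁ parallel)))
      d₂  = proj₂ (Line.direction ℓ)
  in ℚ.1≢0 (trans (cong proj₂ parallel) (trans (cong (_* d₂) r≡0) (ℚ.*-zeroˡ d₂)))

-- Monochromatic strands and order one

Constant : (ℤ → Colour) → Set
Constant f = ∀ k → f (k ℤ.+ + 1) ≡ f k

constant-index : ∀ {f} → Constant f → ∀ a → Constant (f ∘ index a)
constant-index {f} constant (shift b) k = trans (cong f (lemma k b)) (constant (k ℤ.+ b))
  where
  lemma : ∀ k b → k ℤ.+ + 1 ℤ.+ b ≡ k ℤ.+ b ℤ.+ + 1
  lemma = ℤ-Ring.solve-∀
constant-index {f} constant (flip b) k =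
  trans (sym (constant (b ℤ.- (k ℤ.+ + 1)))) (cong f (lemma k b))
  where
  lemma : ∀ k b → b ℤ.- (k ℤ.+ + 1) ℤ.+ + 1 ≡ b ℤ.- k
  lemma = ℤ-Ring.solve-∀

constant-least-period : ∀ {f n} → Constant f → IsLeastPeriod f n → n ℕ.≤ 1
constant-least-period constant (_ , least) = least 1 (ℕ.s≤s ℕ.z≤n , constant)

module _ {c : Design} {n : ℕ} {r : Colour → Colour} {a b : Move}
  (exchange : ∀ i j → r (c (index b j) (index a i)) ≡ c i j) where

  -- The strand that witnesses the order may have either direction. The hypothesis makes every weft
  -- monochromatic, and `exchange` carries this over to the warps.
  equal-columns⇒order≤1 : (∀ j → Constant (λ i → c i j)) → HasOrder c n → n ℕ.≤ 1
  equal-columns⇒order≤1 equal (weft j , least) = constant-least-period (equal j) least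
  equal-columns⇒order≤1 equal (warp i , least) = constant-least-period constant least
    where
    constant : Constant (c i)
    constant k = trans (sym (exchange i (k ℤ.+ + 1)))
      (trans (cong r (constant-index (equal (index a i)) b k)) (exchange i k))

  equal-rows⇒order≤1 : (∀ i → Constant (c i)) → HasOrder c n → n ℕ.≤ 1
  equal-rows⇒order≤1 equal (warp i , least) = constant-least-period (equal i) least
  equal-rows⇒order≤1 equal (weft j , least) = constant-least-period constant least
    where
    constant : Constant (λ k → c k j)
    constant k = trans (sym (exchange (k ℤ.+ + 1) j))
      (trans (cong r (constant-index (equal (index b j)) a k)) (exchange k j))

-- Pairs of equal strands under a move

half : ℤ → ℤ
half i = i /ℕ 2

half-unique : ∀ {i m} → i ℤ.* + 2 ℤ.≤ m → m ℤ.< ℤ.suc i ℤ.* + 2 → half m ≡ i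
half-unique {i} {m} lower upper = ℤ.≤-antisym
  (below (ℤ.≤-<-trans ([n/ℕd]*d≤n m 2) upper)) (below (ℤ.≤-<-trans lower (n<s[n/ℕd]*d m 2)))
  where
  below : ∀ {p q} → p ℤ.* + 2 ℤ.< ℤ.suc q ℤ.* + 2 → p ℤ.≤ q
  below {p} {q} p<q = subst (p ℤ.≤_) (ℤ.pred-suc q) (ℤ.i<j⇒i≤pred[j] (ℤ.*-cancelʳ-<-nonNeg {p} {ℤ.suc q} (+ 2) p<q))

half-even : ∀ i → half (i ℤ.* + 2) ≡ i
half-even i = half-unique ℤ.≤-refl (subst (i ℤ.* + 2 ℤ.<_) (sym (ℤ.suc-* i (+ 2)))
  (subst (ℤ._< + 2 ℤ.+ i ℤ.* + 2) (ℤ.+-identityˡ (i ℤ.* + 2))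
    (ℤ.+-monoˡ-< (i ℤ.* + 2) (ℤ.+<+ (ℕ.s≤s (ℕ.z≤n {1}))))))

half-odd : ∀ i → half (+ 1 ℤ.+ i ℤ.* + 2) ≡ i
half-odd i = half-unique (ℤ.i≤j+i (i ℤ.* + 2) (+ 1))
  (subst (+ 1 ℤ.+ i ℤ.* + 2 ℤ.<_) (sym (ℤ.suc-* i (+ 2)))
    (ℤ.+-monoˡ-< (i ℤ.* + 2) (ℤ.+<+ (ℕ.n<1+n 1))))

parity : ∀ m → (∃[ q ] m ≡ q ℤ.* + 2) ⊎ (∃[ q ] m ≡ + 1 ℤ.+ q ℤ.* + 2)
parity m with m %ℕ 2 | n%ℕd<d m 2 | a≡a%ℕn+[a/ℕn]*n m 2
... | 0 | _ | eq = inj₁ (half m , trans eq (ℤ.+-identityˡ _))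
... | 1 | _ | eq = inj₂ (half m , eq)
... | ℕ.suc (ℕ.suc _) | ℕ.s≤s (ℕ.s≤s ()) | _

-- Only the even member of each pair is tested, as `halved-colours` evaluates the doubled design at
-- no other.
Halves : Move → Move → Set
Halves a a′ = ∀ i → half (index a (i ℤ.* + 2)) ≡ index a′ i

-- The way in which a move fails to respect the pairs: two strands of one pair land in neighbouring
-- pairs, and all neighbours are reached so.
Straddles : Move → Set
Straddles a = ∀ k → ∃[ u ] ∃[ v ]
  half u ≡ half v × half (index a u) ≡ k × half (index a v) ≡ k ℤ.+ + 1

even-shift-halves : ∀ q → Halves (shift (q ℤ.* + 2)) (shift q)
even-shift-halves q i = trans (cong half (lemma q i)) (half-even (i ℤ.+ q))
  where
  lemma : ∀ q i → i ℤ.* + 2 ℤ.+ q ℤ.* + 2 ≡ (i ℤ.+ q) ℤ.* + 2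
  lemma = ℤ-Ring.solve-∀

-- Parities play opposite roles for flips and shifts: with `b` odd, `b - i` sends the even member of
-- a pair to the odd member of its image.
odd-flip-halves : ∀ q → Halves (flip (+ 1 ℤ.+ q ℤ.* + 2)) (flip q)
odd-flip-halves q i = trans (cong half (lemma q i)) (half-odd (q ℤ.- i))
  where
  lemma : ∀ q i → + 1 ℤ.+ q ℤ.* + 2 ℤ.- i ℤ.* + 2 ≡ + 1 ℤ.+ (q ℤ.- i) ℤ.* + 2
  lemma = ℤ-Ring.solve-∀

odd-shift-straddles : ∀ q → Straddles (shift (+ 1 ℤ.+ q ℤ.* + 2))
odd-shift-straddles q k =
  -- The preimages of `2k + 1` and `2k + 2`, the last member of pair `k` and the first of pair
  -- `k + 1`; the even flip below uses the same two targets.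
  (k ℤ.- q) ℤ.* + 2 , + 1 ℤ.+ (k ℤ.- q) ℤ.* + 2 ,
  trans (half-even (k ℤ.- q)) (sym (half-odd (k ℤ.- q))) ,
  trans (cong half (lemma₁ q k)) (half-odd k) ,
  trans (cong half (lemma₂ q k)) (half-even (k ℤ.+ + 1))
  where
  lemma₁ : ∀ q k → (k ℤ.- q) ℤ.* + 2 ℤ.+ (+ 1 ℤ.+ q ℤ.* + 2) ≡ + 1 ℤ.+ k ℤ.* + 2
  lemma₁ = ℤ-Ring.solve-∀
  lemma₂ : ∀ q k → + 1 ℤ.+ (k ℤ.- q) ℤ.* + 2 ℤ.+ (+ 1 ℤ.+ q ℤ.* + 2) ≡ (k ℤ.+ + 1) ℤ.* + 2
  lemma₂ = ℤ-Ring.solve-∀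

even-flip-straddles : ∀ q → Straddles (flip (q ℤ.* + 2))
even-flip-straddles q k =
  + 1 ℤ.+ (q ℤ.- k ℤ.- + 1) ℤ.* + 2 , (q ℤ.- k ℤ.- + 1) ℤ.* + 2 ,
  trans (half-odd (q ℤ.- k ℤ.- + 1)) (sym (half-even (q ℤ.- k ℤ.- + 1))) ,
  trans (cong half (lemma₁ q k)) (half-odd k) ,
  trans (cong half (lemma₂ q k)) (half-even (k ℤ.+ + 1))
  where
  lemma₁ : ∀ q k → q ℤ.* + 2 ℤ.- (+ 1 ℤ.+ (q ℤ.- k ℤ.- + 1) ℤ.* + 2) ≡ + 1 ℤ.+ k ℤ.* + 2
  lemma₁ = ℤ-Ring.solve-∀
  lemma₂ : ∀ q k → q ℤ.* + 2 ℤ.- (q ℤ.- k ℤ.- + 1) ℤ.* + 2 ≡ (k ℤ.+ + 1) ℤ.* + 2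
  lemma₂ = ℤ-Ring.solve-∀

halves-or-straddles : ∀ a → (∃[ a′ ] Halves a a′) ⊎ Straddles a
halves-or-straddles (shift b) with parity b
... | inj₁ (q , refl) = inj₁ (shift q , even-shift-halves q)
... | inj₂ (q , refl) = inj₂ (odd-shift-straddles q)
halves-or-straddles (flip b) with parity b
... | inj₁ (q , refl) = inj₂ (even-flip-straddles q)
... | inj₂ (q , refl) = inj₁ (flip q , odd-flip-halves q)

-- Strands 0 and 1 form one pair. A shift from 0 to 1 is the shift by one, which breaks the pairs;
-- so a move that respects them must be a flip.
unit-move : ∀ a → index a (+ 0) ≡ + 1 → (∃[ m ] Halves a (flip m)) ⊎ Straddles a
unit-move (shift b) eq with trans (sym (ℤ.+-identityˡ b)) eq
... | refl = inj₂ (odd-shift-straddles (+ 0))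
unit-move (flip b) eq with trans (sym (ℤ.+-identityʳ b)) eq
... | refl = inj₁ (+ 0 , odd-flip-halves (+ 0))

-- Symmetries of the doubled design

module _ {c : Design} {ε : Side} {a b : Move}
  (colours : ∀ i j → recolour ε (double c (index a i) (index b j)) ≡ double c i j) where

  -- Columns `u` and `v` of the doubled design are equal, hence so are their images, which are
  -- copies of columns `k` and `k + 1` of `c`.
  straddle⇒equal-columns : Straddles a → ∀ j → Constant (λ i → c i j)
  straddle⇒equal-columns straddles j k with straddles k
  ... | u , v , same , u↦ , v↦ = recolour-injective ε (begin
    recolour ε (c (k ℤ.+ + 1) j)                    ≡⟨ cong₂ (λ x y → recolour ε (c x y)) v↦ w↦ ⟨
    recolour ε (double c (index a v) (index b w))   ≡⟨ colours v w ⟩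
    double c v w                                    ≡⟨ cong (λ x → c x (half w)) same ⟨
    double c u w                                    ≡⟨ colours u w ⟨
    recolour ε (double c (index a u) (index b w))   ≡⟨ cong₂ (λ x y → recolour ε (c x y)) u↦ w↦ ⟩
    recolour ε (c k j)                              ∎)
    where
    open ≡-Reasoning
    -- The row that `b` takes to the even row over `j`.
    w = index (inverse b) (j ℤ.* + 2)
    w↦ : half (index b w) ≡ j
    w↦ = trans (cong half (index-inverseʳ b (j ℤ.* + 2))) (half-even j)

  straddle⇒equal-rows : Straddles b → ∀ i → Constant (c i)
  straddle⇒equal-rows straddles i k with straddles k
  ... | u , v , same , u↦ , v↦ = recolour-injective ε (begin
    recolour ε (c i (k ℤ.+ + 1))                    ≡⟨ cong₂ (λ x y → recolour ε (c x y)) w↦ v↦ ⟨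
    recolour ε (double c (index a w) (index b v))   ≡⟨ colours w v ⟩
    double c w v                                    ≡⟨ cong (c (half w)) same ⟨
    double c w u                                    ≡⟨ colours w u ⟨
    recolour ε (double c (index a w) (index b u))   ≡⟨ cong₂ (λ x y → recolour ε (c x y)) w↦ u↦ ⟩
    recolour ε (c i k)                              ∎)
    where
    open ≡-Reasoning
    w = index (inverse a) (i ℤ.* + 2)
    w↦ : half (index a w) ≡ i
    w↦ = trans (cong half (index-inverseʳ a (i ℤ.* + 2))) (half-even i)

  halved-colours : ∀ {a′ b′} → Halves a a′ → Halves b b′ →
    ∀ i j → recolour ε (c (index a′ i) (index b′ j)) ≡ c i j
  halved-colours a-halves b-halves i j = trans
    (cong₂ (λ x y → recolour ε (c x y)) (sym (a-halves i)) (sym (b-halves j)))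
    (trans (colours (i ℤ.* + 2) (j ℤ.* + 2)) (cong₂ c (half-even i) (half-even j)))

-- The symmetry of the doubled prefabric between warps 0 and 1

theorem1 : (c : Design) (n : ℕ) → Periodic c → Isonemal c → HasOrder c n → 4 < n →
    OnlyParallelAxes c → ¬ Isonemal (double c)
theorem1 c n periodic isonemal order 4<n axes double-isonemal =
  -- Transitivity is used twice: in `c` for a symmetry `f` that exchanges the directions, and in
  -- `double c` for a symmetry `g` that takes warp 0 to its twin.
  let f , δ , f-symmetry , f-onto = isonemal (warp (+ 0)) (weft (+ 0))
      a , b , f-aligned , _       = symmetry-weft {k = + 0} f-symmetry f-onto
      g , ε , g-symmetry , g-onto = double-isonemal (warp (+ 0)) (warp (+ 1))
      p , q , g-aligned , p-index = symmetry-warp {k = + 1} g-symmetry g-onto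
  in conclude {δ = δ} {ε} {a} {b} {p} {q} (δ , f-symmetry) f-aligned
       (transposed-colours f-symmetry f-aligned) (aligned-colours g-symmetry g-aligned)
       (unit-move p p-index) (halves-or-straddles q)
  where
  order≰1 : ¬ n ℕ.≤ 1
  order≰1 n≤1 = ℕ.<⇒≱ 4<n (ℕ.≤-trans n≤1 (ℕ.s≤s ℕ.z≤n))
  conclude : ∀ {f δ ε a b p q} → G₁ c f → Aligned (transpose ∘ f) a b →
    (∀ i j → recolour τ (recolour δ (c (index b j) (index a i))) ≡ c i j) →
    (∀ i j → recolour ε (double c (index p i) (index q j)) ≡ double c i j) →
    (∃[ m ] Halves p (flip m)) ⊎ Straddles p → (∃[ q′ ] Halves q q′) ⊎ Straddles q → ⊥
  conclude {δ = δ} {a = a} {b} {p} {q} _ _ exchange colours (inj₂ straddles) _ =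
    order≰1 (equal-columns⇒order≤1 {r = recolour τ ∘ recolour δ} {a} {b} exchange
      (straddle⇒equal-columns {a = p} {q} colours straddles) order)
  conclude {δ = δ} {a = a} {b} {p} {q} _ _ exchange colours (inj₁ _) (inj₂ straddles) =
    order≰1 (equal-rows⇒order≤1 {r = recolour τ ∘ recolour δ} {a} {b} exchange
      (straddle⇒equal-rows {a = p} {q} colours straddles) order)
  -- Both moves respect the pairs, so halving gives a symmetry of `c` that flips the first
  -- coordinate.
  conclude {ε = ε} {p = p} {q} f∈G₁ f-aligned _ colours (inj₁ (m , p-halves)) (inj₁ (q′ , q-halves)) =
    no-horizontal-flip m q′ axes f∈G₁ f-aligned
      (ε , alignedMap-symmetry (flip m) q′ (halved-colours {a = p} {q} colours {flip m} {q′} p-halves q-halves))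
      record { acts = λ x y → refl }
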